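{- Let $a$ and $b$ be positive integers. All positive integer solutions of the equation $x^{2}-(a^{2}b^{2}-b)y^{2}=1$ are given by $$(x_{n},y_{n})=\begin{cases}\left(\tfrac{1}{2}V_{n}(2a,-1),\;U_{n}(2a,-1)\right) & \text{if } b=1,\\[4pt] \left(\tfrac{1}{2}V_{n}(4a^{2}b-2,-1),\;2a\,U_{n}(4a^{2}b-2,-1)\right) & \text{if } b>1,\end{cases}$$ with $n\ge 1$.
   Context: For non-zero integers $k,s$ with $k^2+4s>0$, the generalized Fibonacci sequence is defined by $U_0(k,s)=0$, $U_1(k,s)=1$, $U_{n+1}(k,s)=kU_n(k,s)+sU_{n-1}(k,s)$ for $n\ge 1$, and the generalized Lucas sequence by $V_0(k,s)=2$, $V_1(k,s)=k$, $V_{n+1}(k,s)=kV_n(k,s)+sV_{n-1}(k,s)$ for $n\ge 1$. -}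

module Defs where

open import Data.Integer using (ℤ; +_; 0ℤ; 1ℤ; _+_; _-_; _*_; _^_; _<_)
open import Data.Nat as ℕ using (ℕ; zero; suc)
open import Data.Product using (_×_; _,_; ∃-syntax)
open import Data.Rational using (ℚ; _/_)
open import Function.Bundles using (_⇔_)
open import Relation.Binary.PropositionalEquality using (_≡_)

-- The recurrences make sense for all k and s. The usual proviso k ^ 2 + 4 s > 0
-- is not imposed: the pair k = 2, s = -1 (discriminant 0) is needed below for
-- a = b = 1, where the equation degenerates to x ^ 2 = 1.

U : ℤ → ℤ → ℕ → ℤ
U k s zero          = 0ℤ
U k s (suc zero)    = 1ℤ
U k s (suc (suc n)) = k * U k s (suc n) + s * U k s n

V : ℤ → ℤ → ℕ → ℤ
V k s zero          = + 2
V k s (suc zero)    = k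
V k s (suc (suc n)) = k * V k s (suc n) + s * V k s n

-- Pairs are rational because the formulas contain the factor 1/2; that the
-- values are integers is part of what is claimed.

PositiveIntegerSolution : ℤ → ℚ × ℚ → Set
PositiveIntegerSolution d p =
  ∃[ x ] ∃[ y ] p ≡ (x / 1 , y / 1) × 0ℤ < x × 0ℤ < y × x ^ 2 - d * y ^ 2 ≡ 1ℤ

AllPositiveSolutionsGivenBy : ℤ → (ℕ → ℚ × ℚ) → Set
AllPositiveSolutionsGivenBy d sol =
  ∀ p → PositiveIntegerSolution d p ⇔ (∃[ n ] 1 ℕ.≤ n × p ≡ sol n)

{-# OPTIONS --safe #-}

-- Let p² − d q² = 1 with p, q > 0 and q minimal among the y > 0 occurring in
-- solutions. Multiplication by p − q √d sends a solution (x, y) with y > 0 to a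
-- solution (x', y') with x' > 0 and 0 ≤ y' < y, so by descent every solution is
-- a power of p + q √d, and these powers satisfy the recurrences of V(2p, -1)/2
-- and q U(2p, -1). For d = a²b² − b one takes (p, q) = (a, 1) if b = 1 and
-- (2a²b − 1, 2a) if b > 1. In the latter case q is minimal: x² = (aby)² − by² + 1
-- forces x ≤ aby − 1, hence y ≥ 2a.
module Submission where

open import Defs
open import Data.Integer using (ℤ; +_; 0ℤ; 1ℤ; -1ℤ; _+_; _-_; -_; _*_; _^_; _<_; _≤_; pred; +≤+; +<+; positive; nonNegative)
open import Data.Integer.Properties
open import Data.Integer.Solver using (module +-*-Solver)
open import Data.Nat as ℕ using (ℕ; zero; suc)
open import Data.Product using (_×_; _,_; ∃-syntax)
open import Data.Rational using (ℚ; _/_)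
open import Data.Rational.Properties using (fromℚᵘ-cong)
open import Data.Rational.Unnormalised using (mkℚᵘ; *≡*)
open import Function.Bundles using (mk⇔)
open import Relation.Binary.Definitions using (tri<; tri≈; tri>)
open import Relation.Binary.PropositionalEquality using (_≡_; refl; sym; trans; cong; cong₂; subst)
open import Relation.Nullary using (contradiction)
open +-*-Solver

-- Signs and squares of integers.

+-nonNeg : ∀ {i j} → 0ℤ ≤ i → 0ℤ ≤ j → 0ℤ ≤ i + j
+-nonNeg = +-mono-≤

+-pos-nonNeg : ∀ {i j} → 0ℤ < i → 0ℤ ≤ j → 0ℤ < i + j
+-pos-nonNeg = +-mono-<-≤

+-nonNeg-pos : ∀ {i j} → 0ℤ ≤ i → 0ℤ < j → 0ℤ < i + j
+-nonNeg-pos = +-mono-≤-<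

*-pos : ∀ {i j} → 0ℤ < i → 0ℤ < j → 0ℤ < i * j
*-pos {i} {j} 0<i 0<j =
  subst (_< i * j) (*-zeroʳ i) (*-monoˡ-<-pos i {{positive 0<i}} 0<j)

*-nonNeg : ∀ {i j} → 0ℤ ≤ i → 0ℤ ≤ j → 0ℤ ≤ i * j
*-nonNeg {i} {j} 0≤i 0≤j =
  subst (_≤ i * j) (*-zeroʳ i) (*-monoˡ-≤-nonNeg i {{nonNegative 0≤i}} 0≤j)

^2-pos : ∀ {i} → 0ℤ < i → 0ℤ < i ^ 2
-- `i ^ 2` unfolds to `i * (i * 1ℤ)`, hence the two nested products.
^2-pos 0<i = *-pos 0<i (*-pos 0<i (+<+ (ℕ.s≤s ℕ.z≤n)))

^2-nonNeg : ∀ {i} → 0ℤ ≤ i → 0ℤ ≤ i ^ 2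
^2-nonNeg 0≤i = *-nonNeg 0≤i (*-nonNeg 0≤i (+≤+ ℕ.z≤n))

0<i-j⇒j<i : ∀ {i j} → 0ℤ < i - j → j < i
0<i-j⇒j<i 0<i-j = ≰⇒> λ i≤j → ≤⇒≯ (i≤j⇒i-j≤0 i≤j) 0<i-j

i<j⇒0<j-i : ∀ {i j} → i < j → 0ℤ < j - i
i<j⇒0<j-i {i} {j} i<j = subst (_< j - i) (+-inverseʳ i) (+-monoˡ-< (- i) i<j)

^2-mono-≤ : ∀ {i j} → 0ℤ ≤ i → i ≤ j → i ^ 2 ≤ j ^ 2
^2-mono-≤ {i} {j} 0≤i i≤j = 0≤i-j⇒j≤i (subst (0ℤ ≤_)
  (solve 2 (λ i j → (j :- i) :* (j :+ i) := j :^ 2 :- i :^ 2) refl i j)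
  (*-nonNeg (i≤j⇒0≤j-i i≤j) (+-nonNeg (≤-trans 0≤i i≤j) 0≤i)))

^2-mono-< : ∀ {i j} → 0ℤ ≤ i → i < j → i ^ 2 < j ^ 2
^2-mono-< {i} {j} 0≤i i<j = 0<i-j⇒j<i (subst (0ℤ <_)
  (solve 2 (λ i j → (j :- i) :* (j :+ i) := j :^ 2 :- i :^ 2) refl i j)
  (*-pos (i<j⇒0<j-i i<j) (+-pos-nonNeg (≤-<-trans 0≤i i<j) 0≤i)))

-- Stated with a difference of squares because the norm equations turn such differences into
-- expressions of visible sign.
^2-cancel-< : ∀ {i j} → 0ℤ ≤ j → 0ℤ < j ^ 2 - i ^ 2 → i < j
^2-cancel-< 0≤j 0<j²-i² =
  ≰⇒> λ j≤i → ≤⇒≯ (^2-mono-≤ 0≤j j≤i) (0<i-j⇒j<i 0<j²-i²)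

^2-cancel-≤ : ∀ {i j} → 0ℤ ≤ j → 0ℤ ≤ j ^ 2 - i ^ 2 → i ≤ j
^2-cancel-≤ 0≤j 0≤j²-i² =
  ≮⇒≥ λ j<i → ≤⇒≯ (0≤i-j⇒j≤i 0≤j²-i²) (^2-mono-< 0≤j j<i)

[2*i]/2≡i/1 : ∀ i → (+ 2 * i) / 2 ≡ i / 1
-- `mkℚᵘ` stores the denominator minus one, so 1 and 0 encode the denominators 2 and 1.
[2*i]/2≡i/1 i = fromℚᵘ-cong {mkℚᵘ (+ 2 * i) 1} {mkℚᵘ i 0}
  (*≡* (solve 1 (λ i → con (+ 2) :* i :* con 1ℤ := i :* con (+ 2)) refl i))

-- Pell's equation with a known minimal solution.

module Pell (d p q : ℤ) (0≤d : 0ℤ ≤ d) (0<p : 0ℤ < p) (0<q : 0ℤ < q)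
            (norm-pq : p ^ 2 - d * q ^ 2 ≡ 1ℤ)
            (q-minimal : ∀ {x y} → 0ℤ < x → 0ℤ < y → x ^ 2 - d * y ^ 2 ≡ 1ℤ → q ≤ y)
            where

  -- X n + Y n √d = (p + q √d) ^ n
  X Y : ℕ → ℤ
  X zero    = 1ℤ
  X (suc n) = p * X n + d * q * Y n
  Y zero    = 0ℤ
  Y (suc n) = p * Y n + q * X n

  -- Brahmagupta's identity: the norm x² - d y² is multiplicative.
  norm-XY : ∀ n → X n ^ 2 - d * Y n ^ 2 ≡ 1ℤ
  norm-XY zero = solve 1 (λ d → con 1ℤ :^ 2 :- d :* con 0ℤ :^ 2 := con 1ℤ) refl d
  norm-XY (suc n) = trans
    (solve 5 (λ d p q x y →
        (p :* x :+ d :* q :* y) :^ 2 :- d :* (p :* y :+ q :* x) :^ 2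
        := (p :^ 2 :- d :* q :^ 2) :* (x :^ 2 :- d :* y :^ 2))
      refl d p q (X n) (Y n))
    (cong₂ _*_ norm-pq (norm-XY n))

  X-pos    : ∀ n → 0ℤ < X n
  Y-nonNeg : ∀ n → 0ℤ ≤ Y n
  X-pos zero    = +<+ (ℕ.s≤s ℕ.z≤n)
  X-pos (suc n) = +-pos-nonNeg (*-pos 0<p (X-pos n))
                             (*-nonNeg (*-nonNeg 0≤d (<⇒≤ 0<q)) (Y-nonNeg n))
  Y-nonNeg zero    = +≤+ ℕ.z≤n
  Y-nonNeg (suc n) = +-nonNeg (*-nonNeg (<⇒≤ 0<p) (Y-nonNeg n))
                              (*-nonNeg (<⇒≤ 0<q) (<⇒≤ (X-pos n)))

  Y-suc-pos : ∀ n → 0ℤ < Y (suc n)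
  Y-suc-pos n = +-nonNeg-pos (*-nonNeg (<⇒≤ 0<p) (Y-nonNeg n)) (*-pos 0<q (X-pos n))

  -- `p + q √d` has trace 2p and norm 1, so it is a root of t² = 2p t - 1. The solver's identity
  -- keeps the norm as a coefficient, which `norm-pq` then replaces by 1.
  X-recurrence : ∀ n → X (suc (suc n)) ≡ + 2 * p * X (suc n) + -1ℤ * X n
  X-recurrence n = trans
    (solve 5 (λ d p q x y →
        p :* (p :* x :+ d :* q :* y) :+ d :* q :* (p :* y :+ q :* x)
        := con (+ 2) :* p :* (p :* x :+ d :* q :* y) :+ (:- (p :^ 2 :- d :* q :^ 2)) :* x)
      refl d p q (X n) (Y n))
    (cong (λ m → + 2 * p * X (suc n) + (- m) * X n) norm-pq)

  Y-recurrence : ∀ n → Y (suc (suc n)) ≡ + 2 * p * Y (suc n) + -1ℤ * Y n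
  Y-recurrence n = trans
    (solve 5 (λ d p q x y →
        p :* (p :* y :+ q :* x) :+ q :* (p :* x :+ d :* q :* y)
        := con (+ 2) :* p :* (p :* y :+ q :* x) :+ (:- (p :^ 2 :- d :* q :^ 2)) :* y)
      refl d p q (X n) (Y n))
    (cong (λ m → + 2 * p * Y (suc n) + (- m) * Y n) norm-pq)

  -- Both sides are the trace of `(p + q √d) ^ n`: they share the recurrence and the first two
  -- values.
  V≡2X : ∀ n → V (+ 2 * p) -1ℤ n ≡ + 2 * X n
  V≡2X zero       = refl
  V≡2X (suc zero) =
    solve 3 (λ d p q → con (+ 2) :* p
                       := con (+ 2) :* (p :* con 1ℤ :+ d :* q :* con 0ℤ)) refl d p q
  V≡2X (suc (suc n)) = trans
    (cong₂ (λ v w → + 2 * p * v + -1ℤ * w) (V≡2X (suc n)) (V≡2X n))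
    (trans
      (solve 3 (λ p x x' →
          con (+ 2) :* p :* (con (+ 2) :* x') :+ con -1ℤ :* (con (+ 2) :* x)
          := con (+ 2) :* (con (+ 2) :* p :* x' :+ con -1ℤ :* x))
        refl p (X n) (X (suc n)))
      (cong (+ 2 *_) (sym (X-recurrence n))))

  qU≡Y : ∀ n → q * U (+ 2 * p) -1ℤ n ≡ Y n
  qU≡Y zero       = *-zeroʳ q
  qU≡Y (suc zero) =
    solve 2 (λ p q → q :* con 1ℤ := p :* con 0ℤ :+ q :* con 1ℤ) refl p q
  qU≡Y (suc (suc n)) = trans
    (solve 4 (λ p q u u' →
        q :* (con (+ 2) :* p :* u' :+ con -1ℤ :* u)
        := con (+ 2) :* p :* (q :* u') :+ con -1ℤ :* (q :* u))
      refl p q (U (+ 2 * p) -1ℤ n) (U (+ 2 * p) -1ℤ (suc n)))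
    (trans
      (cong₂ (λ v w → + 2 * p * v + -1ℤ * w) (qU≡Y (suc n)) (qU≡Y n))
      (sym (Y-recurrence n)))

  -- One descent step: multiplication by `p - q √d`.

  module Descent {x y : ℤ} (0<x : 0ℤ < x) (0<y : 0ℤ < y)
                 (norm-xy : x ^ 2 - d * y ^ 2 ≡ 1ℤ) where

    x' y' : ℤ
    x' = p * x - d * q * y
    y' = p * y - q * x

    norm-x'y' : x' ^ 2 - d * y' ^ 2 ≡ 1ℤ
    norm-x'y' = trans
      (solve 5 (λ d p q x y →
          (p :* x :- d :* q :* y) :^ 2 :- d :* (p :* y :- q :* x) :^ 2
          := (p :^ 2 :- d :* q :^ 2) :* (x :^ 2 :- d :* y :^ 2))
        refl d p q x y)
      (cong₂ _*_ norm-pq norm-xy)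

    -- With both norms equal to 1, (p x)² - (d q y)² = 1 + d q² + d y².
    0<x' : 0ℤ < x'
    0<x' = i<j⇒0<j-i (^2-cancel-< (*-nonNeg (<⇒≤ 0<p) (<⇒≤ 0<x))
      (subst (0ℤ <_) (sym (trans
        (solve 5 (λ d p q x y →
            (p :* x) :^ 2 :- (d :* q :* y) :^ 2
            := (p :^ 2 :- d :* q :^ 2) :* (x :^ 2 :- d :* y :^ 2)
               :+ (d :* q :^ 2 :* (x :^ 2 :- d :* y :^ 2)
                   :+ d :* y :^ 2 :* (p :^ 2 :- d :* q :^ 2)))
          refl d p q x y)
        (cong₂ (λ m n → m * n + (d * q ^ 2 * n + d * y ^ 2 * m)) norm-pq norm-xy)))
      (+-pos-nonNeg (+<+ (ℕ.s≤s ℕ.z≤n))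
        (+-nonNeg (*-nonNeg (*-nonNeg 0≤d (^2-nonNeg (<⇒≤ 0<q))) (+≤+ ℕ.z≤n))
                  (*-nonNeg (*-nonNeg 0≤d (^2-nonNeg (<⇒≤ 0<y))) (+≤+ ℕ.z≤n))))))

    -- With both norms equal to 1, (p y)² - (q x)² = y² - q², and minimality of `q` makes this
    -- non-negative.
    0≤y' : 0ℤ ≤ y'
    0≤y' = i≤j⇒0≤j-i (^2-cancel-≤ (*-nonNeg (<⇒≤ 0<p) (<⇒≤ 0<y))
      (subst (0ℤ ≤_) (sym (trans
        (solve 5 (λ d p q x y →
            (p :* y) :^ 2 :- (q :* x) :^ 2
            := (p :^ 2 :- d :* q :^ 2) :* y :^ 2 :- (x :^ 2 :- d :* y :^ 2) :* q :^ 2)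
          refl d p q x y)
        (cong₂ (λ m n → m * y ^ 2 - n * q ^ 2) norm-pq norm-xy)))
      (i≤j⇒0≤j-i (*-monoˡ-≤-nonNeg 1ℤ
        (^2-mono-≤ (<⇒≤ 0<q) (q-minimal 0<x 0<y norm-xy))))))

    -- y' < y is (p − 1) y < q x.
    y'<y : y' < y
    y'<y = 0<i-j⇒j<i (subst (0ℤ <_)
      (solve 4 (λ p q x y → q :* x :- (p :- con 1ℤ) :* y := y :- (p :* y :- q :* x))
        refl p q x y)
      -- The two squares differ by q² + 2 (p - 1) y², which is positive because p ≥ 1.
      (i<j⇒0<j-i (^2-cancel-< (*-nonNeg (<⇒≤ 0<q) (<⇒≤ 0<x))
        (subst (0ℤ <_) (sym (trans
          (solve 5 (λ d p q x y →
              (q :* x) :^ 2 :- ((p :- con 1ℤ) :* y) :^ 2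
              := q :^ 2 :* (x :^ 2 :- d :* y :^ 2)
                 :+ (con 1ℤ :+ con (+ 2) :* (p :- con 1ℤ) :- (p :^ 2 :- d :* q :^ 2)) :* y :^ 2)
            refl d p q x y)
          (cong₂ (λ m n → q ^ 2 * n + (1ℤ + + 2 * (p - 1ℤ) - m) * y ^ 2) norm-pq norm-xy)))
        (+-pos-nonNeg (*-pos (^2-pos 0<q) (+<+ (ℕ.s≤s ℕ.z≤n)))
          (*-nonNeg
            (subst (0ℤ ≤_)
              (solve 1 (λ p → con (+ 2) :* (p :- con 1ℤ)
                              := con 1ℤ :+ con (+ 2) :* (p :- con 1ℤ) :- con 1ℤ) refl p)
              (*-nonNeg {+ 2} (+≤+ ℕ.z≤n) (i≤j⇒0≤j-i (i<j⇒suc[i]≤j 0<p))))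
            (^2-nonNeg (<⇒≤ 0<y))))))))

    -- As `p + q √d` has norm 1, multiplying by it undoes the multiplication by its conjugate.
    x-recovered : p * x' + d * q * y' ≡ x
    x-recovered = trans
      (solve 5 (λ d p q x y →
          p :* (p :* x :- d :* q :* y) :+ d :* q :* (p :* y :- q :* x)
          := (p :^ 2 :- d :* q :^ 2) :* x)
        refl d p q x y)
      (trans (cong (_* x) norm-pq) (*-identityˡ x))

    y-recovered : p * y' + q * x' ≡ y
    y-recovered = trans
      (solve 5 (λ d p q x y →
          p :* (p :* y :- q :* x) :+ q :* (p :* x :- d :* q :* y)
          := (p :^ 2 :- d :* q :^ 2) :* y)
        refl d p q x y)
      (trans (cong (_* y) norm-pq) (*-identityˡ y))

  -- Every solution is a power.

  1-unique : ∀ {x} → 0ℤ < x → x ^ 2 - d * 0ℤ ^ 2 ≡ 1ℤ → x ≡ 1ℤ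
  1-unique {x} 0<x norm = ≤-antisym
    (^2-cancel-≤ {x} {1ℤ} (+≤+ ℕ.z≤n) (≤-reflexive (sym (i≡j⇒i-j≡0 (sym x²≡1)))))
    (i<j⇒suc[i]≤j 0<x)
    where
    x²≡1 : x ^ 2 ≡ 1ℤ
    x²≡1 = trans
      (solve 2 (λ d x → x :^ 2 := x :^ 2 :- d :* con 0ℤ :^ 2) refl d x) norm

  -- m bounds the number of remaining descent steps.
  all-solutions : ∀ m {x y} → y ≤ + m → 0ℤ < x → 0ℤ ≤ y → x ^ 2 - d * y ^ 2 ≡ 1ℤ →
                  ∃[ n ] x ≡ X n × y ≡ Y n
  all-solutions m {x} {y} y≤m 0<x 0≤y norm with <-cmp 0ℤ y
  ... | tri> _ _ y<0 = contradiction y<0 (≤⇒≯ 0≤y)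
  ... | tri≈ _ refl _ = 0 , 1-unique 0<x norm , refl
  all-solutions zero y≤0 0<x 0≤y norm | tri< 0<y _ _ = contradiction 0<y (≤⇒≯ y≤0)
  all-solutions (suc m) {x} {y} y≤1+m 0<x 0≤y norm | tri< 0<y _ _ =
    let n , x'≡ , y'≡ = all-solutions m (i<j⇒i≤pred[j] (<-≤-trans y'<y y≤1+m)) 0<x' 0≤y' norm-x'y'
    in suc n
     , trans (sym x-recovered) (cong₂ (λ u v → p * u + d * q * v) x'≡ y'≡)
     , trans (sym y-recovered) (cong₂ (λ u v → p * v + q * u) x'≡ y'≡)
    where open Descent 0<x 0<y norm

  positive-solution : ∀ {x y} → 0ℤ < x → 0ℤ < y → x ^ 2 - d * y ^ 2 ≡ 1ℤ →
                      ∃[ n ] 1 ℕ.≤ n × x ≡ X n × y ≡ Y n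
  positive-solution {y = + m} 0<x 0<y norm
    -- `y` serves as its own bound on the descent; the index 0 is excluded because it would force y
    -- = 0.
    with all-solutions m ≤-refl 0<x (<⇒≤ 0<y) norm
  ... | zero  , _  , y≡0 = contradiction (sym y≡0) (<⇒≢ 0<y)
  ... | suc n , eq       = suc n , ℕ.s≤s ℕ.z≤n , eq

  -- From powers to the rational formulas.

  -- The coefficient `k` is tied to `+ 2 * p` by an equation because `+ 4 * a ^ 2 * b - + 2` has
  -- that form only after rearrangement.
  formula : ∀ {k} → k ≡ + 2 * p → ∀ n →
            (V k -1ℤ n / 2 , (q * U k -1ℤ n) / 1) ≡ (X n / 1 , Y n / 1)
  formula refl n = cong₂ _,_
    (trans (cong (_/ 2) (V≡2X n)) ([2*i]/2≡i/1 (X n)))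
    (cong (_/ 1) (qU≡Y n))

  all-positive-solutions : (sol : ℕ → ℚ × ℚ) → (∀ n → sol n ≡ (X n / 1 , Y n / 1)) →
                           AllPositiveSolutionsGivenBy d sol
  all-positive-solutions sol sol≡ r = mk⇔
    (λ (x , y , r≡ , 0<x , 0<y , norm) →
      let n , 1≤n , x≡ , y≡ = positive-solution 0<x 0<y norm
      in n , 1≤n , trans r≡ (trans (cong₂ (λ u v → (u / 1 , v / 1)) x≡ y≡) (sym (sol≡ n))))
    -- Only successors occur, since 1 ≤ n; this is also what makes `Y` positive.
    (λ { (suc n , _ , r≡) →
      X (suc n) , Y (suc n) , trans r≡ (sol≡ (suc n)) , X-pos (suc n) , Y-suc-pos n
      , norm-XY (suc n) })

-- The family d = a²b² - b.

-- Factor out `b` and use a²b ≥ 1. Equality occurs at a = b = 1, so `Pell` must admit d = 0.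
a²b²-b-nonNeg : ∀ {a b} → 0ℤ < a → 0ℤ < b → 0ℤ ≤ a ^ 2 * b ^ 2 - b
a²b²-b-nonNeg {a} {b} 0<a 0<b = subst (0ℤ ≤_)
  (solve 2 (λ a b → b :* (a :^ 2 :* b :- con 1ℤ) := a :^ 2 :* b :^ 2 :- b) refl a b)
  (*-nonNeg (<⇒≤ 0<b) (i≤j⇒0≤j-i (i<j⇒suc[i]≤j (*-pos (^2-pos 0<a) 0<b))))

-- If y < 2a, then x lies strictly between the consecutive integers a b y - 1 and a b y: the
-- relevant differences of squares are b y (2a - y) and (b - 1) y² + (y² - 1). The second is
-- positive because b > 1.
2a-minimal : ∀ {a b} → 0ℤ < a → 1ℤ < b → ∀ {x y} → 0ℤ < x → 0ℤ < y →
             x ^ 2 - (a ^ 2 * b ^ 2 - b) * y ^ 2 ≡ 1ℤ → + 2 * a ≤ y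
2a-minimal {a} {b} 0<a 1<b {x} {y} 0<x 0<y norm =
  ≮⇒≥ λ y<2a → ≤⇒≯ (i<j⇒i≤pred[j] x<c) (pred[c]<x y<2a)
  where
  0<b : 0ℤ < b
  0<b = <-trans (+<+ (ℕ.s≤s ℕ.z≤n)) 1<b

  c : ℤ
  c = a * b * y

  x<c : x < c
  x<c = ^2-cancel-< (<⇒≤ (*-pos (*-pos 0<a 0<b) 0<y)) (subst (0ℤ <_)
    (sym (trans
      (solve 4 (λ a b x y →
          (a :* b :* y) :^ 2 :- x :^ 2
          := (b :- con 1ℤ) :* y :^ 2
             :+ (y :^ 2 :- (x :^ 2 :- (a :^ 2 :* b :^ 2 :- b) :* y :^ 2)))
        refl a b x y)
      (cong (λ m → (b - 1ℤ) * y ^ 2 + (y ^ 2 - m)) norm)))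
    (+-pos-nonNeg (*-pos (i<j⇒0<j-i 1<b) (^2-pos 0<y))
                (i≤j⇒0≤j-i (i<j⇒suc[i]≤j (^2-pos 0<y)))))

  pred[c]<x : y < + 2 * a → pred c < x
  pred[c]<x y<2a = ^2-cancel-< (<⇒≤ 0<x) (subst (0ℤ <_)
    (sym (trans
      (solve 4 (λ a b x y →
          x :^ 2 :- (con -1ℤ :+ a :* b :* y) :^ 2
          := b :* y :* (con (+ 2) :* a :- y)
             :+ ((x :^ 2 :- (a :^ 2 :* b :^ 2 :- b) :* y :^ 2) :- con 1ℤ))
        refl a b x y)
      (cong (λ m → b * y * (+ 2 * a - y) + (m - 1ℤ)) norm)))
    (+-pos-nonNeg (*-pos (*-pos 0<b 0<y) (i<j⇒0<j-i y<2a)) ≤-refl))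

theorem5 : (a b : ℤ) → 0ℤ < a → 0ℤ < b →
    (b ≡ 1ℤ → AllPositiveSolutionsGivenBy (a ^ 2 * b ^ 2 - b)
    (λ n → (V (+ 2 * a) -1ℤ n / 2 , U (+ 2 * a) -1ℤ n / 1)))
    ×
    (1ℤ < b → AllPositiveSolutionsGivenBy (a ^ 2 * b ^ 2 - b)
    (λ n → (V (+ 4 * a ^ 2 * b - + 2) -1ℤ n / 2 , (+ 2 * a * U (+ 4 * a ^ 2 * b - + 2) -1ℤ n) / 1)))
theorem5 a b 0<a 0<b = case-b≡1 , case-1<b
  where
  case-b≡1 : b ≡ 1ℤ → AllPositiveSolutionsGivenBy (a ^ 2 * b ^ 2 - b)
    (λ n → (V (+ 2 * a) -1ℤ n / 2 , U (+ 2 * a) -1ℤ n / 1))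
  case-b≡1 refl = P.all-positive-solutions _ λ n → trans
    (cong (λ u → (V (+ 2 * a) -1ℤ n / 2 , u / 1)) (sym (*-identityˡ (U (+ 2 * a) -1ℤ n))))
    (P.formula refl n)
    where
    -- Here d = a² - 1, and q = 1 is the least positive integer. After matching on `refl`, `0<b`
    -- says 0 < 1 and gives the positivity of q.
    module P = Pell (a ^ 2 * 1ℤ ^ 2 - 1ℤ) a 1ℤ (a²b²-b-nonNeg 0<a 0<b) 0<a 0<b
      (solve 1 (λ a → a :^ 2 :- (a :^ 2 :* con 1ℤ :^ 2 :- con 1ℤ) :* con 1ℤ :^ 2 := con 1ℤ)
        refl a)
      (λ _ 0<y _ → i<j⇒suc[i]≤j 0<y)

  case-1<b : 1ℤ < b → AllPositiveSolutionsGivenBy (a ^ 2 * b ^ 2 - b)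
    (λ n → (V (+ 4 * a ^ 2 * b - + 2) -1ℤ n / 2 , (+ 2 * a * U (+ 4 * a ^ 2 * b - + 2) -1ℤ n) / 1))
  case-1<b 1<b = P.all-positive-solutions _ (P.formula
    (solve 2 (λ a b → con (+ 4) :* a :^ 2 :* b :- con (+ 2)
                      := con (+ 2) :* (con (+ 2) :* a :^ 2 :* b :- con 1ℤ)) refl a b))
    where
    0<a²b : 0ℤ < a ^ 2 * b
    0<a²b = *-pos (^2-pos 0<a) 0<b

    -- The element a b + √d has norm b; its square divided by b is (2a²b - 1) + 2a √d, of norm 1.
    module P = Pell (a ^ 2 * b ^ 2 - b) (+ 2 * a ^ 2 * b - 1ℤ) (+ 2 * a)
      (a²b²-b-nonNeg 0<a 0<b)
      (subst (0ℤ <_)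
        (solve 2 (λ a b → a :^ 2 :* b :+ (a :^ 2 :* b :- con 1ℤ)
                          := con (+ 2) :* a :^ 2 :* b :- con 1ℤ) refl a b)
        (+-pos-nonNeg 0<a²b (i≤j⇒0≤j-i (i<j⇒suc[i]≤j 0<a²b))))
      (*-pos {+ 2} (+<+ (ℕ.s≤s ℕ.z≤n)) 0<a)
      (solve 2 (λ a b →
          (con (+ 2) :* a :^ 2 :* b :- con 1ℤ) :^ 2
          :- (a :^ 2 :* b :^ 2 :- b) :* (con (+ 2) :* a) :^ 2 := con 1ℤ) refl a b)
      (2a-minimal 0<a 1<b)
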